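{- Let $G$ and $H$ be finite simple connected graphs, neither of which is a complete graph. Then $tn(G\boxtimes H)\le 3$.
   Context: The strong product $G\boxtimes H$ has vertex set $V(G)\times V(H)$; $(g_1,h_1)$ and $(g_2,h_2)$ are adjacent iff ($g_1g_2\in E(G)$ and $h_1=h_2$) or ($g_1=g_2$ and $h_1h_2\in E(H)$) or ($g_1g_2\in E(G)$ and $h_1h_2\in E(H)$). For two different non-adjacent vertices $u,v$ of a graph $F$, a tolled walk between $u$ and $v$ is a sequence of vertices $u,w_1,\dots,w_k,v$ with $k\ge 1$ such that consecutive vertices of $w_1,\dots,w_k$ are adjacent, $uw_i\in E(F)$ if and only if $i=1$, and $vw_i\in E(F)$ if and only if $i=k$. If $uv\in E(F)$, the only tolled walk between $u$ and $v$ is $u,v$; the only tolled walk from $v$ to itself is the single vertex $v$. The toll interval $T_F(u,v)$ is the set of all vertices of $F$ lying on some tolled walk between $u$ and $v$. For $S\subseteq V(F)$ the toll closure is $T_F[S]=\bigcup_{u,v\in S}T_F(u,v)$. $S$ is a toll set of $F$ if $T_F[S]=V(F)$, and the toll number $tn(F)$ is the minimum size of a toll set of $F$. -}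

module Defs where

open import Level using (0ℓ)
open import Data.Nat using (ℕ; suc; _≤_; _*_)
open import Data.Fin using (Fin; zero; suc; inject₁; fromℕ)
open import Data.Fin.Properties using (*↔×; inj⇒≟)
open import Data.Fin.Subset using (Subset; ∣_∣) renaming (_∈_ to _∈ₛ_)
open import Data.List using (List; []; _∷_; [_]; _++_; tabulate)
open import Data.List.Membership.Propositional using () renaming (_∈_ to _∈ₗ_)
open import Data.Product using (_×_; _,_; ∃-syntax; Σ-syntax)
open import Data.Product.Function.NonDependent.Propositional using (_×-↔_)
open import Data.Sum using (_⊎_; inj₁; inj₂)
open import Function using (_↔_; _⇔_; Inverse)
open import Function.Properties.Inverse using (↔-trans; ↔-sym; Inverse⇒Injection)
open import Relation.Binary using (Rel; Symmetric; Irreflexive; Decidable; DecidableEquality)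
open import Relation.Binary.Construct.Closure.ReflexiveTransitive using (Star)
open import Relation.Binary.PropositionalEquality using (_≡_; _≢_; refl; sym)
open import Relation.Nullary using (¬_)
open import Relation.Nullary.Decidable using (_×-dec_; _⊎-dec_)
open import Relation.Unary using (Pred; _∈_)

-- Finite simple graphs. Decidability of adjacency is automatic classically;
-- decidability of vertex equality follows from the enumeration.
record Graph : Set₁ where
  field
    V         : Set
    order     : ℕ
    enum      : V ↔ Fin order
    Adj       : Rel V 0ℓ
    adj?      : Decidable Adj
    adj-sym   : Symmetric Adj
    adj-irrefl : Irreflexive _≡_ Adj

  index : V → Fin order
  index = Inverse.to enum

  infix 4 _≟_
  _≟_ : DecidableEquality V
  _≟_ = inj⇒≟ (Inverse⇒Injection enum)

module _ (G : Graph) where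
  open Graph G

  Connected : Set
  Connected = ∀ u v → Star Adj u v

  Complete : Set
  Complete = ∀ u v → u ≢ v → Adj u v

module _ (G H : Graph) where
  private
    module G = Graph G
    module H = Graph H

  StrongAdj : Rel (G.V × H.V) 0ℓ
  StrongAdj (g₁ , h₁) (g₂ , h₂) =
      (G.Adj g₁ g₂ × h₁ ≡ h₂)
    ⊎ (g₁ ≡ g₂ × H.Adj h₁ h₂)
    ⊎ (G.Adj g₁ g₂ × H.Adj h₁ h₂)

  private
    strong-sym : Symmetric StrongAdj
    strong-sym (inj₁ (a , e))        = inj₁ (G.adj-sym a , sym e)
    strong-sym (inj₂ (inj₁ (e , b))) = inj₂ (inj₁ (sym e , H.adj-sym b))
    strong-sym (inj₂ (inj₂ (a , b))) = inj₂ (inj₂ (G.adj-sym a , H.adj-sym b))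

    strong-irrefl : Irreflexive _≡_ StrongAdj
    strong-irrefl refl (inj₁ (a , _))        = G.adj-irrefl refl a
    strong-irrefl refl (inj₂ (inj₁ (_ , b))) = H.adj-irrefl refl b
    strong-irrefl refl (inj₂ (inj₂ (a , _))) = G.adj-irrefl refl a

  infixr 7 _⊠_
  _⊠_ : Graph
  _⊠_ = record
    { V          = G.V × H.V
    ; order      = G.order * H.order
    ; enum       = ↔-trans (G.enum ×-↔ H.enum) (↔-sym *↔×)
    ; Adj        = StrongAdj
    ; adj?       = λ { (g₁ , h₁) (g₂ , h₂) →
                       (G.adj? g₁ g₂ ×-dec (h₁ H.≟ h₂))
                ⊎-dec ((g₁ G.≟ g₂) ×-dec H.adj? h₁ h₂)
                ⊎-dec (G.adj? g₁ g₂ ×-dec H.adj? h₁ h₂) }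
    ; adj-sym    = strong-sym
    ; adj-irrefl = strong-irrefl
    }

module _ (F : Graph) where
  open Graph F

  -- In `tolled`, the interior w₁ , … , w_k has k = suc m, so it is indexed
  -- from zero (for w₁) to fromℕ m (for w_k).
  data TolledWalk (u v : V) : Set where
    trivial : u ≡ v → TolledWalk u v
    edge    : Adj u v → TolledWalk u v
    tolled  : u ≢ v → ¬ Adj u v →
              (m : ℕ) (w : Fin (suc m) → V) →
              (∀ (i : Fin m) → Adj (w (inject₁ i)) (w (suc i))) →
              (∀ i → Adj u (w i) ⇔ i ≡ zero) →
              (∀ i → Adj v (w i) ⇔ i ≡ fromℕ m) →
              TolledWalk u v

  vertices : ∀ {u v} → TolledWalk u v → List V
  vertices {u} {v} (trivial _)            = [ v ]
  vertices {u} {v} (edge _)               = u ∷ [ v ]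
  vertices {u} {v} (tolled _ _ _ w _ _ _) = u ∷ tabulate w ++ [ v ]

  TollInterval : V → V → Pred V 0ℓ
  TollInterval u v x = Σ[ p ∈ TolledWalk u v ] x ∈ₗ vertices p

  -- A set of vertices is a `Subset order`, read through the enumeration.
  TollClosure : Subset order → Pred V 0ℓ
  TollClosure S x =
    ∃[ u ] ∃[ v ] index u ∈ₛ S × index v ∈ₛ S × x ∈ TollInterval u v

  IsTollSet : Subset order → Set
  IsTollSet S = ∀ x → x ∈ TollClosure S

  -- tn(F) = k: the number k is attained as the size of a toll set, and it is
  -- a lower bound for the sizes of all toll sets.
  IsTollNumber : ℕ → Set
  IsTollNumber k =
      (∃[ S ] IsTollSet S × ∣ S ∣ ≡ k)
    × (∀ S → IsTollSet S → k ≤ ∣ S ∣)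

{-# OPTIONS --safe #-}

-- Write N[p] for the closed neighbourhood of p. If g and h are not universal
-- in G and H, then the complement of N[(g , h)] = N[g] × N[h] is connected: a
-- vertex whose first coordinate avoids N[g] may move freely in the second one,
-- and vice versa. Hence for such non-adjacent p ≠ q, the toll interval of p and
-- q contains every x with N[x] ⊈ N[p] and N[x] ⊈ N[q]. No x has its closed
-- neighbourhood inside both N[p] and N[q], since then p ∈ N[x] ⊆ N[q]. So among
-- three pairwise non-adjacent vertices, every x is in the toll interval of two.
-- Such vertices are (g₁ , h₁), (g₁ , h₂), (g₂ , h₁) with g₁, g₂ and h₁, h₂
-- non-adjacent.
--
-- Constructively, the minimum exists because being a toll set is decidable:
-- tolled walks through a vertex reduce to reachability in a finite relation.

module Submission where

open import Defs
open import Level using (0ℓ)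
open import Data.Bool using (true; false)
open import Data.Fin using (Fin; zero; suc; inject₁; fromℕ)
open import Data.Fin.Induction using (<-weakInduction; >-weakInduction)
open import Data.Fin.Properties using (fromℕ≢inject₁; suc-injective)
open import Data.Fin.Subset using (Subset; ∣_∣; ⁅_⁆; _∪_) renaming (_∈_ to _∈ₛ_)
open import Data.Fin.Subset.Properties
  using (anySubset?; ∣⁅x⁆∣≡1; x∈⁅x⁆; x∈p∪q⁺; _∈?_)
open import Data.List using (List; []; _∷_; map; allFin; tabulate)
open import Data.List.Membership.Propositional using (lose) renaming (_∈_ to _∈ₗ_)
open import Data.List.Membership.Propositional.Properties
  using (∈-map⁺; ∈-allFin; ∈-tabulate⁺; ∈-tabulate⁻; ∈-++⁺ˡ; ∈-++⁻)
import Data.List.Relation.Unary.All as All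
open import Data.List.Relation.Unary.Any as Any using (here; there)
open import Data.Nat using (ℕ; zero; suc; _+_; _≤_; _<_; z≤n; s≤s)
open import Data.Nat.Induction using (<-wellFounded)
open import Data.Nat.Properties
  using (anyUpTo?; ≮⇒≥; ≤-trans; ≤-reflexive; <⇒≤; ≤-refl; +-mono-≤; +-suc; m≤n⇒m≤1+n)
  renaming (_≟_ to _≟ℕ_)
open import Data.Product using (_×_; _,_; ∃; ∃-syntax; Σ-syntax; proj₁; proj₂)
open import Data.Sum using (_⊎_; inj₁; inj₂)
open import Data.Vec using ([]; _∷_)
import Data.Vec.Functional as Vector
open import Function using (_∘_; _⇔_; mk⇔; Inverse; Equivalence)
open import Induction.WellFounded using (Acc; acc)
open import Relation.Binary using (Rel; Decidable; DecidableEquality; Symmetric)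
open import Relation.Binary.Construct.Closure.Reflexive using (ReflClosure; refl; [_])
import Relation.Binary.Construct.Closure.Reflexive.Properties as Refl
open import Relation.Binary.Construct.Closure.ReflexiveTransitive as Star
  using (Star; ε; _◅_; _◅◅_)
open import Relation.Binary.PropositionalEquality
  using (_≡_; _≢_; refl; sym; cong; subst)
open import Relation.Nullary using (¬_; Dec; yes; no; contradiction)
open import Relation.Nullary.Decidable using (_×-dec_; _⊎-dec_; ¬?; map′; decidable-stable)
open import Relation.Unary using (Pred) renaming (Decidable to Decidable₁)

-- Minima of decidable predicates and sizes of unions.

least : {P : Pred ℕ 0ℓ} → Decidable₁ P → ∀ {n} → P n →
        ∃[ k ] P k × (∀ j → P j → k ≤ j) × k ≤ n
least {P} P? {n} = go n (<-wellFounded n)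
  where
  go : ∀ n → Acc _<_ n → P n → ∃[ k ] P k × (∀ j → P j → k ≤ j) × k ≤ n
  go n (acc rec) Pn with anyUpTo? P? n
  ... | no  ∄j = n , Pn , (λ j Pj → ≮⇒≥ λ j<n → ∄j (j , j<n , Pj)) , ≤-refl
  ... | yes (j , j<n , Pj) with go j (rec j<n) Pj
  ...   | k , Pk , k-min , k≤j = k , Pk , k-min , ≤-trans k≤j (<⇒≤ j<n)

∣p∪q∣≤∣p∣+∣q∣ : ∀ {n} (p q : Subset n) → ∣ p ∪ q ∣ ≤ ∣ p ∣ + ∣ q ∣
∣p∪q∣≤∣p∣+∣q∣ []          []          = z≤n
∣p∪q∣≤∣p∣+∣q∣ (false ∷ p) (false ∷ q) = ∣p∪q∣≤∣p∣+∣q∣ p q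
∣p∪q∣≤∣p∣+∣q∣ (false ∷ p) (true  ∷ q) =
  ≤-trans (s≤s (∣p∪q∣≤∣p∣+∣q∣ p q)) (≤-reflexive (sym (+-suc ∣ p ∣ ∣ q ∣)))
∣p∪q∣≤∣p∣+∣q∣ (true  ∷ p) (false ∷ q) = s≤s (∣p∪q∣≤∣p∣+∣q∣ p q)
∣p∪q∣≤∣p∣+∣q∣ (true  ∷ p) (true  ∷ q) =
  s≤s (≤-trans (m≤n⇒m≤1+n (∣p∪q∣≤∣p∣+∣q∣ p q)) (≤-reflexive (sym (+-suc ∣ p ∣ ∣ q ∣))))

module _ {A : Set} (_≟_ : DecidableEquality A) {R : Rel A 0ℓ} (R? : Decidable R) where

  -- Warshall's algorithm: the list holds the allowed intermediate points.
  Via : List A → Rel A 0ℓ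
  Via []       a b = ReflClosure R a b
  Via (p ∷ ps) a b = Via ps a b ⊎ (Via ps a p × Via ps p b)

  via? : ∀ ps → Decidable (Via ps)
  via? []       a b = Refl.dec _≟_ R? a b
  via? (p ∷ ps) a b = via? ps a b ⊎-dec (via? ps a p ×-dec via? ps p b)

  Via⇒Star : ∀ ps {a b} → Via ps a b → Star R a b
  Via⇒Star []       refl             = ε
  Via⇒Star []       [ aRb ]          = aRb ◅ ε
  Via⇒Star (p ∷ ps) (inj₁ v)         = Via⇒Star ps v
  Via⇒Star (p ∷ ps) (inj₂ (v₁ , v₂)) = Via⇒Star ps v₁ ◅◅ Via⇒Star ps v₂

  ReflClosure⇒Via : ∀ ps {a b} → ReflClosure R a b → Via ps a b
  ReflClosure⇒Via []       r = r
  ReflClosure⇒Via (p ∷ ps) r = inj₁ (ReflClosure⇒Via ps r)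

  -- If the junction is the pivot itself, both halves are trimmed to meet there. If both halves pass
  -- through another pivot `p`, the loop from `p` through `c` back to `p` is cut out.
  Via-trans : ∀ ps {a c b} → c ∈ₗ ps → Via ps a c → Via ps c b → Via ps a b
  Via-trans (p ∷ ps) {a} {c} {b} (here refl) v w = inj₂ (into v , out w)
    where
    into : Via (c ∷ ps) a c → Via ps a c
    into (inj₁ v)       = v
    into (inj₂ (v , _)) = v
    out : Via (c ∷ ps) c b → Via ps c b
    out (inj₁ w)       = w
    out (inj₂ (_ , w)) = w
  Via-trans (p ∷ ps) (there c∈) (inj₁ v) (inj₁ w) = inj₁ (Via-trans ps c∈ v w)
  Via-trans (p ∷ ps) (there c∈) (inj₁ v) (inj₂ (w₁ , w₂)) =
    inj₂ (Via-trans ps c∈ v w₁ , w₂)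
  Via-trans (p ∷ ps) (there c∈) (inj₂ (v₁ , v₂)) (inj₁ w) =
    inj₂ (v₁ , Via-trans ps c∈ v₂ w)
  Via-trans (p ∷ ps) (there c∈) (inj₂ (v₁ , _)) (inj₂ (_ , w₂)) = inj₂ (v₁ , w₂)

  Star⇒Via : ∀ ps → (∀ a → a ∈ₗ ps) → ∀ {a b} → Star R a b → Via ps a b
  Star⇒Via ps ∈ps ε         = ReflClosure⇒Via ps refl
  Star⇒Via ps ∈ps (r ◅ rs) =
    Via-trans ps (∈ps _) (ReflClosure⇒Via ps [ r ]) (Star⇒Via ps ∈ps rs)

  star? : ∀ ps → (∀ a → a ∈ₗ ps) → Decidable (Star R)
  star? ps ∈ps a b = map′ (Via⇒Star ps) (Star⇒Via ps ∈ps) (via? ps a b)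

-- Finite search over vertices, and closed neighbourhoods.

module _ (F : Graph) where
  open Graph F

  allVertices : List V
  allVertices = map (Inverse.from enum) (allFin order)

  ∈-allVertices : ∀ x → x ∈ₗ allVertices
  ∈-allVertices x = subst (_∈ₗ allVertices) (Inverse.strictlyInverseʳ enum x)
    (∈-map⁺ (Inverse.from enum) (∈-allFin (index x)))

  any? : {P : Pred V 0ℓ} → Decidable₁ P → Dec (∃ P)
  any? P? = map′ Any.satisfied (λ (x , Px) → lose (∈-allVertices x) Px)
    (Any.any? P? allVertices)

  all? : {P : Pred V 0ℓ} → Decidable₁ P → Dec (∀ x → P x)
  all? P? = map′ (λ ps x → All.lookup ps (∈-allVertices x)) (λ f → All.universal f allVertices)
    (All.all? P? allVertices)

  -- `Adj⁼ p` is the closed neighbourhood N[p].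
  Adj⁼ : Rel V 0ℓ
  Adj⁼ = ReflClosure Adj

  adj⁼? : Decidable Adj⁼
  adj⁼? = Refl.dec _≟_ adj?

  adj⁼-sym : Symmetric Adj⁼
  adj⁼-sym = Refl.sym adj-sym

  -- Finite search decides whether such a pair exists, which justifies arguing by contradiction.
  ¬complete⇒far : ¬ Complete F → ∃[ u ] ∃[ v ] ¬ Adj⁼ u v
  ¬complete⇒far ¬complete = decidable-stable
    (any? λ u → any? λ v → ¬? (adj⁼? u v))
    λ ∄far → ¬complete λ u v u≢v →
      decidable-stable (adj? u v) λ ¬uv → ∄far (u , v , λ
        { refl   → u≢v refl
        ; [ uv ] → ¬uv uv })

  -- Tolled walks as paths in a restricted relation.

  -- A step inside the interior of a tolled walk from u to v: only the first
  -- interior vertex may be adjacent to u, and only the last one to v.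
  Step : V → V → Rel V 0ℓ
  Step u v x y = Adj x y × ¬ Adj v x × ¬ Adj u y

  step-sym : ∀ {u v x y} → Step u v x y → Step v u y x
  step-sym (xy , ¬vx , ¬uy) = adj-sym xy , ¬uy , ¬vx

  -- `Step` puts its two conditions on opposite ends of an edge, so a path into `x` and a path out
  -- of `x` combine with no further check at `x`.
  ReachableFrom ReachesTo Through : V → V → Pred V 0ℓ
  ReachableFrom u v x = ∃[ s ] Adj u s × Star (Step u v) s x
  ReachesTo     u v x = ∃[ t ] Adj v t × Star (Step u v) x t
  Through       u v x = ReachableFrom u v x × ReachesTo u v x

  reachesTo⇒reachableFrom : ∀ {u v x} → ReachesTo v u x → ReachableFrom u v x
  reachesTo⇒reachableFrom (s , us , x→s) = s , us , Star.reverse step-sym x→s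

  step*? : ∀ u v → Decidable (Star (Step u v))
  step*? u v = star? _≟_ (λ x y → adj? x y ×-dec ¬? (adj? v x) ×-dec ¬? (adj? u y))
    allVertices ∈-allVertices

  through? : ∀ u v → Decidable₁ (Through u v)
  through? u v x =
          any? (λ s → adj? u s ×-dec step*? u v s x)
    ×-dec any? (λ t → adj? v t ×-dec step*? u v x t)

  interior⇒through : ∀ {u v} m (w : Fin (suc m) → V) →
    (∀ (i : Fin m) → Adj (w (inject₁ i)) (w (suc i))) →
    (∀ i → Adj u (w i) ⇔ i ≡ zero) →
    (∀ i → Adj v (w i) ⇔ i ≡ fromℕ m) →
    ∀ i → Through u v (w i)
  interior⇒through {u} {v} m w steps at-u at-v i =
      (_ , Equivalence.from (at-u zero) refl
         , <-weakInduction (λ i → Star (Step u v) (w zero) (w i)) ε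
             (λ j p → p ◅◅ step j ◅ ε) i)
    , (_ , Equivalence.from (at-v (fromℕ m)) refl
         , >-weakInduction (λ i → Star (Step u v) (w i) (w (fromℕ m))) ε
             (λ j p → step j ◅ p) i)
    where
    step : ∀ j → Step u v (w (inject₁ j)) (w (suc j))
    step j = steps j
           -- The source of a step is never the last interior vertex, and its target is never the
           -- first.
           , (λ vw → fromℕ≢inject₁ (sym (Equivalence.to (at-v (inject₁ j)) vw)))
           , (λ uw → contradiction (Equivalence.to (at-u (suc j)) uw) λ ())

  -- A final segment, beginning in x, of the interior of a tolled walk from u to v.
  record Tail (u v x : V) : Set where
    field
      len    : ℕ
      w      : Fin (suc len) → V
      start  : w zero ≡ x
      steps  : ∀ (i : Fin len) → Adj (w (inject₁ i)) (w (suc i))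
      -- The first vertex is exempt: it may be the neighbour of `u` that opens the interior.
      avoids : ∀ i → ¬ Adj u (w (suc i))
      at-v   : ∀ i → Adj v (w i) ⇔ i ≡ fromℕ len

  _On_ : ∀ {u v x} → V → Tail u v x → Set
  y On T = ∃[ i ] Tail.w T i ≡ y

  singleton : ∀ {u v x} → Adj v x → Tail u v x
  singleton {x = x} vx = record
    { len    = 0
    ; w      = λ _ → x
    ; start  = refl
    ; steps  = λ ()
    ; avoids = λ ()
    ; at-v   = λ { zero → mk⇔ (λ _ → refl) (λ _ → vx) }
    }

  cons : ∀ {u v x y} → Step u v x y → Tail u v y → Tail u v x
  cons {u} {v} {x} (xy , ¬vx , ¬uy) T = record
    { len    = suc T.len
    ; w      = x Vector.∷ T.w
    ; start  = refl
    ; steps  = λ { zero    → subst (Adj x) (sym T.start) xy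
                 ; (suc i) → T.steps i }
    ; avoids = λ { zero    → ¬uy ∘ subst (Adj u) T.start
                 ; (suc i) → T.avoids i }
    ; at-v   = λ { zero    → mk⇔ (λ vx → contradiction vx ¬vx) (λ ())
                 ; (suc i) → mk⇔ (cong suc ∘ Equivalence.to (T.at-v i))
                                 (Equivalence.from (T.at-v i) ∘ suc-injective) }
    }
    where module T = Tail T

  -- The marked vertex `z` is carried along, so that its position on the final walk is known.
  prepend : ∀ {u v x y z} → Star (Step u v) x y →
            (Σ[ T ∈ Tail u v y ] z On T) → Σ[ T ∈ Tail u v x ] z On T
  prepend ε        T = T
  prepend (s ◅ ss) T with prepend ss T
  ... | T′ , i , eq = cons s T′ , suc i , eq

  through⇒tollInterval : ∀ {u v x} → u ≢ v → ¬ Adj u v → Through u v x → TollInterval F u v x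
  through⇒tollInterval {u} {v} {x} u≢v ¬uv ((s , us , s→x) , (t , vt , x→t))
    -- The walk is built from its far end. The mark on `t` is dropped here; the next extension marks
    -- `x`.
    with tail , _ ← prepend x→t (singleton vt , zero , refl)
    with T , i , wi≡x ← prepend s→x (tail , zero , Tail.start tail)
    = tolled u≢v ¬uv T.len T.w T.steps at-u T.at-v
    , there (∈-++⁺ˡ (subst (_∈ₗ tabulate T.w) wi≡x (∈-tabulate⁺ {f = T.w} i)))
    where
    module T = Tail T
    at-u : ∀ i → Adj u (T.w i) ⇔ i ≡ zero
    at-u zero    = mk⇔ (λ _ → refl) (λ _ → subst (Adj u) (sym T.start) us)
    at-u (suc i) = mk⇔ (λ uw → contradiction uw (T.avoids i)) (λ ())

  -- Deciding toll sets, and existence of the toll number.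

  Covered : Subset order → Pred V 0ℓ
  Covered S x = index x ∈ₛ S ⊎
    (∃[ u ] ∃[ v ] index u ∈ₛ S × index v ∈ₛ S × ¬ Adj⁼ u v × Through u v x)

  covered? : ∀ S → Decidable₁ (Covered S)
  covered? S x = (index x ∈? S) ⊎-dec
    any? λ u → any? λ v → (index u ∈? S) ×-dec (index v ∈? S) ×-dec
      ¬? (adj⁼? u v) ×-dec through? u v x

  covered⇒closure : ∀ {S x} → Covered S x → TollClosure F S x
  covered⇒closure {x = x} (inj₁ x∈) = x , x , x∈ , x∈ , trivial refl , here refl
  covered⇒closure (inj₂ (u , v , u∈ , v∈ , far , thr)) =
    u , v , u∈ , v∈ , through⇒tollInterval (λ { refl → far refl }) (far ∘ [_]) thr

  -- The ends of a walk lie in `S`, and interior vertices satisfy `Through`; quantifying over walks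
  -- thus becomes a finite search.
  closure⇒covered : ∀ {S x} → TollClosure F S x → Covered S x
  closure⇒covered (u , v , u∈ , v∈ , trivial _ , here refl)       = inj₁ v∈
  closure⇒covered (u , v , u∈ , v∈ , edge _ , here refl)          = inj₁ u∈
  closure⇒covered (u , v , u∈ , v∈ , edge _ , there (here refl))  = inj₁ v∈
  closure⇒covered (u , v , u∈ , v∈ , tolled _ _ _ _ _ _ _ , here refl) = inj₁ u∈
  closure⇒covered (u , v , u∈ , v∈ , tolled u≢v ¬uv m w steps at-u at-v , there x∈)
    with ∈-++⁻ (tabulate w) x∈
  ... | inj₂ (here refl) = inj₁ v∈
  ... | inj₁ x∈w with ∈-tabulate⁻ {f = w} x∈w
  ...   | i , refl = inj₂ (u , v , u∈ , v∈
    , (λ { refl → u≢v refl ; [ uv ] → ¬uv uv })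
    , interior⇒through m w steps at-u at-v i)

  isTollSet? : Decidable₁ (IsTollSet F)
  isTollSet? S = all? λ x → map′ covered⇒closure closure⇒covered (covered? S x)

  tollNumber≤ : ∀ {S n} → IsTollSet F S → ∣ S ∣ ≤ n → ∃[ k ] IsTollNumber F k × k ≤ n
  tollNumber≤ {S} S-toll ∣S∣≤n
    with k , attained , k-min , k≤ ←
      least (λ k → anySubset? λ S → isTollSet? S ×-dec (∣ S ∣ ≟ℕ k)) (S , S-toll , refl)
    = k , (attained , λ S S-toll → k-min ∣ S ∣ (S , S-toll , refl)) , ≤-trans k≤ ∣S∣≤n

  -- From connected complements of closed neighbourhoods to toll intervals.

  Outside : V → Rel V 0ℓ
  Outside p x y = Adj x y × ¬ Adj⁼ p x × ¬ Adj⁼ p y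

  outside-sym : ∀ {p x y} → Outside p x y → Outside p y x
  outside-sym (xy , ¬px , ¬py) = adj-sym xy , ¬py , ¬px

  OutsideConnected : Pred V 0ℓ
  OutsideConnected p = ∀ {x y} → ¬ Adj⁼ p x → ¬ Adj⁼ p y → Star (Outside p) x y

  -- This is N[x] ⊈ N[p].
  Undominated : V → Pred V 0ℓ
  Undominated p x = ∃[ y ] Adj⁼ x y × ¬ Adj⁼ p y

  -- The witness is `q` if it lies in N[x], and otherwise `x` itself, which then avoids N[q].
  undominated-by-one : ∀ {p q} → ¬ Adj⁼ p q → ∀ x → Undominated p x ⊎ Undominated q x
  undominated-by-one {p} {q} far x with adj⁼? x q
  ... | yes xq = inj₁ (q , xq , far)
  ... | no ¬xq = inj₂ (x , refl , ¬xq ∘ adj⁼-sym)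

  -- Cut the path at its first neighbour of `q`. As long as `x` is not adjacent to `q`, the next
  -- vertex differs from `q`, so the recursion can continue.
  reachesTo : ∀ {p q x} → x ≢ q → Star (λ a b → Adj a b × ¬ Adj p b) x q → ReachesTo p q x
  reachesTo x≢q ε = contradiction refl x≢q
  reachesTo {p} {q} {x} x≢q (_◅_ {j = y} (xy , ¬py) y→q) with adj? q x
  ... | yes qx = x , qx , ε
  ... | no ¬qx
    with t , qt , y→t ← reachesTo (λ { refl → ¬qx (adj-sym xy) }) y→q
    = t , qt , (xy , ¬qx , ¬py) ◅ y→t

  -- Move from `x` to a vertex outside N[p], staying put if `x` is one, then travel outside N[p] to
  -- `q`. The start `x` may be adjacent to `p`, as only targets of steps must avoid it. The vertex
  -- `z` shows that `x` is not `q`.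
  undominated⇒reachesTo : ∀ {p q x} → OutsideConnected p → ¬ Adj⁼ p q →
                          Undominated p x → Undominated q x → ReachesTo p q x
  undominated⇒reachesTo {p} {q} {x} conn far (y , xy , ¬py) (z , xz , ¬qz) =
    reachesTo (λ { refl → ¬qz xz })
      (first xy ◅◅ Star.map (λ (ab , _ , ¬pb) → ab , ¬pb ∘ [_]) (conn ¬py far))
    where
    first : Adj⁼ x y → Star (λ a b → Adj a b × ¬ Adj p b) x y
    first refl   = ε
    first [ xy ] = (xy , ¬py ∘ [_]) ◅ ε

  undominated⇒through : ∀ {p q x} → OutsideConnected p → OutsideConnected q → ¬ Adj⁼ p q →
                        Undominated p x → Undominated q x → Through p q x
  undominated⇒through conn-p conn-q far p-un q-un =
      reachesTo⇒reachableFrom (undominated⇒reachesTo conn-q (far ∘ adj⁼-sym) q-un p-un)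
    , undominated⇒reachesTo conn-p far p-un q-un

  tollNumber≤3 : ∀ {p q r} →
    OutsideConnected p → OutsideConnected q → OutsideConnected r →
    ¬ Adj⁼ p q → ¬ Adj⁼ p r → ¬ Adj⁼ q r →
    ∃[ k ] IsTollNumber F k × k ≤ 3
  tollNumber≤3 {p} {q} {r} conn-p conn-q conn-r ¬pq ¬pr ¬qr =
    tollNumber≤ (covered⇒closure ∘ covered) ∣S∣≤3
    where
    S : Subset order
    S = ⁅ index p ⁆ ∪ (⁅ index q ⁆ ∪ ⁅ index r ⁆)

    p∈ : index p ∈ₛ S
    p∈ = x∈p∪q⁺ (inj₁ (x∈⁅x⁆ _))
    q∈ : index q ∈ₛ S
    q∈ = x∈p∪q⁺ (inj₂ (x∈p∪q⁺ (inj₁ (x∈⁅x⁆ _))))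
    r∈ : index r ∈ₛ S
    r∈ = x∈p∪q⁺ (inj₂ (x∈p∪q⁺ (inj₂ (x∈⁅x⁆ _))))

    ∣S∣≤3 : ∣ S ∣ ≤ 3
    ∣S∣≤3 = ≤-trans (∣p∪q∣≤∣p∣+∣q∣ ⁅ index p ⁆ _)
      (+-mono-≤ (≤-reflexive (∣⁅x⁆∣≡1 (index p)))
        (≤-trans (∣p∪q∣≤∣p∣+∣q∣ ⁅ index q ⁆ ⁅ index r ⁆)
          (+-mono-≤ (≤-reflexive (∣⁅x⁆∣≡1 (index q))) (≤-reflexive (∣⁅x⁆∣≡1 (index r))))))

    via-pq : ∀ {x} → Undominated p x → Undominated q x → Covered S x
    via-pq a b = inj₂ (p , q , p∈ , q∈ , ¬pq , undominated⇒through conn-p conn-q ¬pq a b)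
    via-pr : ∀ {x} → Undominated p x → Undominated r x → Covered S x
    via-pr a b = inj₂ (p , r , p∈ , r∈ , ¬pr , undominated⇒through conn-p conn-r ¬pr a b)
    via-qr : ∀ {x} → Undominated q x → Undominated r x → Covered S x
    via-qr a b = inj₂ (q , r , q∈ , r∈ , ¬qr , undominated⇒through conn-q conn-r ¬qr a b)

    covered : ∀ x → Covered S x
    -- If the first answer is `p`, the third adds `q` or `r`; if it is `q`, the second adds `p` or
    -- `r`. Either way two distinct vertices result.
    covered x with undominated-by-one ¬pq x | undominated-by-one ¬pr x | undominated-by-one ¬qr x
    ... | inj₁ a | _      | inj₁ b = via-pq a b
    ... | inj₁ a | _      | inj₂ b = via-pr a b
    ... | inj₂ a | inj₁ b | _      = via-pq b a
    ... | inj₂ a | inj₂ b | _      = via-qr a b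

-- Complements of closed neighbourhoods in the strong product.

module _ (G H : Graph) where
  private
    module G = Graph G
    module H = Graph H
    F = G ⊠ H

  adj⁼-×⁺ : ∀ {a b c d} → Adj⁼ G a c → Adj⁼ H b d → Adj⁼ F (a , b) (c , d)
  adj⁼-×⁺ refl   refl   = refl
  adj⁼-×⁺ refl   [ bd ] = [ inj₂ (inj₁ (refl , bd)) ]
  adj⁼-×⁺ [ ac ] refl   = [ inj₁ (ac , refl) ]
  adj⁼-×⁺ [ ac ] [ bd ] = [ inj₂ (inj₂ (ac , bd)) ]

  adj⁼-×⁻ : ∀ {a b c d} → Adj⁼ F (a , b) (c , d) → Adj⁼ G a c × Adj⁼ H b d
  adj⁼-×⁻ refl                      = refl , refl
  adj⁼-×⁻ [ inj₁ (ac , refl) ]        = [ ac ] , refl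
  adj⁼-×⁻ [ inj₂ (inj₁ (refl , bd)) ] = refl , [ bd ]
  adj⁼-×⁻ [ inj₂ (inj₂ (ac , bd)) ]   = [ ac ] , [ bd ]

  module _ (G-conn : Connected G) (H-conn : Connected H)
           {g g′ h h′} (¬gg′ : ¬ Adj⁼ G g g′) (¬hh′ : ¬ Adj⁼ H h h′) where

    along-H : ∀ {a} → ¬ Adj⁼ G g a → ∀ b b′ → Star (Outside F (g , h)) (a , b) (a , b′)
    along-H ¬ga b b′ = Star.gmap (_ ,_)
      (λ bb′ → inj₂ (inj₁ (refl , bb′)) , ¬ga ∘ proj₁ ∘ adj⁼-×⁻ , ¬ga ∘ proj₁ ∘ adj⁼-×⁻)
      (H-conn b b′)

    along-G : ∀ {b} → ¬ Adj⁼ H h b → ∀ a a′ → Star (Outside F (g , h)) (a , b) (a′ , b)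
    along-G ¬hb a a′ = Star.gmap (_, _)
      (λ aa′ → inj₁ (aa′ , refl) , ¬hb ∘ proj₂ ∘ adj⁼-×⁻ , ¬hb ∘ proj₂ ∘ adj⁼-×⁻)
      (G-conn a a′)

    -- Both coordinates of the hub `(g′ , h′)` are outside, so once one coordinate has been moved
    -- into place, the other is free to move.
    to-hub : ∀ {x} → ¬ Adj⁼ F (g , h) x → Star (Outside F (g , h)) x (g′ , h′)
    to-hub {a , b} far with adj⁼? G g a
    ... | no ¬ga = along-H ¬ga b h′ ◅◅ along-G ¬hh′ a g′
    -- Since `a` lies in N[g], `b` must avoid N[h].
    ... | yes ga = along-G (far ∘ adj⁼-×⁺ ga) a g′ ◅◅ along-H ¬gg′ b h′

    outsideConnected : OutsideConnected F (g , h)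
    outsideConnected far-x far-y =
      to-hub far-x ◅◅ Star.reverse (outside-sym F) (to-hub far-y)

theorem4p1 : (G H : Graph) →
    Connected G → Connected H →
    ¬ Complete G → ¬ Complete H →
    ∃[ k ] IsTollNumber (G ⊠ H) k × k ≤ 3
theorem4p1 G H G-conn H-conn ¬G-complete ¬H-complete
  with g₁ , g₂ , ¬g₁g₂ ← ¬complete⇒far G ¬G-complete
     | h₁ , h₂ , ¬h₁h₂ ← ¬complete⇒far H ¬H-complete
  = tollNumber≤3 (G ⊠ H) {g₁ , h₁} {g₁ , h₂} {g₂ , h₁}
      -- In each factor the other vertex of the far pair serves as the hub coordinate.
      (connected ¬g₁g₂ ¬h₁h₂) (connected ¬g₁g₂ ¬h₂h₁) (connected ¬g₂g₁ ¬h₁h₂)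
      (¬h₁h₂ ∘ proj₂ ∘ adj⁼-×⁻ G H) (¬g₁g₂ ∘ proj₁ ∘ adj⁼-×⁻ G H)
      (¬g₁g₂ ∘ proj₁ ∘ adj⁼-×⁻ G H)
  where
  connected = outsideConnected G H G-conn H-conn
  ¬g₂g₁ = ¬g₁g₂ ∘ adj⁼-sym G
  ¬h₂h₁ = ¬h₁h₂ ∘ adj⁼-sym H
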